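{- Let $G$ be a connected graph containing a swap set such that $\alpha(G)=3$. Then $DD_{\mathrm{m}}(G) \leq \alpha(G)$.
   Context: Graphs are finite, simple and undirected; $\alpha(G)$ is the independence number. Swap number: a dominating set $D$ of a graph $G$ is a swap set if there is a dominating set $D'$ of $G$ with $D\cap D'=\emptyset$, $|D|=|D'|$, such that $G$ contains a perfect matching between $D$ and $D'$ (a bijection $f:D\to D'$ with $x f(x)\in E(G)$ for all $x\in D$). $DD_{\mathrm{m}}(G)$ is the minimum cardinality of a swap set of $G$, and $DD_{\mathrm{m}}(G)=\infty$ if none exists. -}

module Defs where

open import Data.Empty using (⊥-elim)
open import Data.Fin using (Fin; funToFin; finToFun)
open import Data.Fin.Properties using (any?; all?; _≟_; finToFun-funToFin)
open import Data.Fin.Subset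
open import Data.Fin.Subset.Properties using (_∈?_; anySubset?; nonempty?; ∣⊥∣≡0; ∉⊥)
open import Data.List using (List; []; _∷_; _++_; map; filter)
open import Data.List.Membership.Propositional using () renaming (_∈_ to _∈ˡ_)
open import Data.List.Membership.Propositional.Properties
  using (∈-++⁺ˡ; ∈-++⁺ʳ; ∈-map⁺; ∈-map⁻; ∈-filter⁺; ∈-filter⁻)
open import Data.List.Relation.Unary.Any using (here)
open import Data.Nat as ℕ using (ℕ; zero; suc; _≤_)
import Data.Nat.Properties as ℕ
import Data.List.Extrema.Nat as Max
import Data.List.Extrema as Extrema
import Data.List.Relation.Unary.All as All
open import Data.Product using (∃; Σ-syntax; ∃-syntax; _×_; _,_; proj₁; proj₂)
open import Data.Sum using (_⊎_; inj₁; inj₂)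
open import Data.Vec using ([]; _∷_)
open import Data.Vec.Properties.WithK using ([]=-irrelevant)
open import Function using (_∘_)
open import Level using (0ℓ)
open import Function.Bundles using (_⤖_; mk⤖; module Bijection)
open import Relation.Binary using (Rel; Symmetric; Irreflexive; Decidable; TotalOrder)
open import Relation.Binary.Construct.Closure.ReflexiveTransitive using (Star)
open import Relation.Binary.PropositionalEquality
open import Relation.Nullary using (¬_; Dec; yes; no)
open import Relation.Nullary.Decidable using (map′; _×-dec_; _⊎-dec_; _→-dec_; ¬?)
open import Relation.Nullary.Construct.Add.Supremum using (_⁺; [_]; ⊤⁺)
open import Relation.Binary.Construct.Add.Supremum.NonStrict ℕ._≤_
  using (_≤⁺_; ≤⁺-isTotalOrder-≡) public

record Graph (n : ℕ) : Set₁ where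
  field
    Adj        : Rel (Fin n) 0ℓ
    adj?       : Decidable Adj
    adj-sym    : Symmetric Adj
    adj-irrefl : Irreflexive _≡_ Adj

allSubsets : ∀ n → List (Subset n)
allSubsets zero    = [] ∷ []
allSubsets (suc n) = map (outside ∷_) (allSubsets n) ++ map (inside ∷_) (allSubsets n)

∈-allSubsets : ∀ {n} (S : Subset n) → S ∈ˡ allSubsets n
∈-allSubsets []            = here refl
∈-allSubsets (outside ∷ S) = ∈-++⁺ˡ (∈-map⁺ (outside ∷_) (∈-allSubsets S))
∈-allSubsets {suc n} (inside ∷ S) =
  ∈-++⁺ʳ (map (outside ∷_) (allSubsets n)) (∈-map⁺ (inside ∷_) (∈-allSubsets S))

-- ℕ with an added top element ⊤⁺ = ∞.
ℕ∞ : Set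
ℕ∞ = ℕ ⁺

ℕ∞-totalOrder : TotalOrder 0ℓ 0ℓ 0ℓ
ℕ∞-totalOrder = record { isTotalOrder = ≤⁺-isTotalOrder-≡ ℕ.≤-isTotalOrder }

private module Min = Extrema ℕ∞-totalOrder

module _ {n : ℕ} (G : Graph n) where
  open Graph G using (Adj; adj?)

  Connected : Set
  Connected = ∀ u v → Star Adj u v

  IsIndependent : Subset n → Set
  IsIndependent S = ∀ u v → u ∈ S → v ∈ S → ¬ Adj u v

  IsDominating : Subset n → Set
  IsDominating D = ∀ v → v ∈ D ⊎ ∃[ u ] (u ∈ D × Adj u v)

  PerfectMatching : Subset n → Subset n → Set
  PerfectMatching D D′ =
    Σ[ f ∈ ∃ (_∈ D) ⤖ ∃ (_∈ D′) ] (∀ x → Adj (proj₁ x) (proj₁ (Bijection.to f x)))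

  IsSwapSet : Subset n → Set
  IsSwapSet D = IsDominating D × ∃[ D′ ]
    (IsDominating D′ × Empty (D ∩ D′) × ∣ D ∣ ≡ ∣ D′ ∣ × PerfectMatching D D′)

  independent? : ∀ S → Dec (IsIndependent S)
  independent? S = all? λ u → all? λ v → (u ∈? S) →-dec ((v ∈? S) →-dec ¬? (adj? u v))

  dominating? : ∀ D → Dec (IsDominating D)
  dominating? D = all? λ v → (v ∈? D) ⊎-dec any? λ u → (u ∈? D) ×-dec adj? u v

  private
    -- PerfectMatching for a map defined on all vertices, of which only the
    -- restriction to D matters; used only to decide PerfectMatching.
    MatchingMap : Subset n → Subset n → (Fin n → Fin n) → Set
    MatchingMap D D′ f =
        (∀ x → x ∈ D → f x ∈ D′ × Adj x (f x))
      × (∀ x y → x ∈ D → y ∈ D → f x ≡ f y → x ≡ y)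
      × (∀ y → y ∈ D′ → ∃[ x ] (x ∈ D × f x ≡ y))

    matchingMap? : ∀ D D′ f → Dec (MatchingMap D D′ f)
    matchingMap? D D′ f =
            (all? λ x → (x ∈? D) →-dec ((f x ∈? D′) ×-dec adj? x (f x)))
      ×-dec (all? λ x → all? λ y → (x ∈? D) →-dec ((y ∈? D) →-dec ((f x ≟ f y) →-dec (x ≟ y))))
      ×-dec (all? λ y → (y ∈? D′) →-dec any? λ x → (x ∈? D) ×-dec (f x ≟ y))

    MatchingMap-resp-≗ : ∀ {D D′ f g} → f ≗ g → MatchingMap D D′ f → MatchingMap D D′ g
    MatchingMap-resp-≗ {D} {D′} f≗g (m , i , s) =
        (λ x x∈D → subst (λ z → z ∈ D′ × Adj x z) (f≗g x) (m x x∈D))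
      , (λ x y x∈D y∈D eq → i x y x∈D y∈D (trans (f≗g x) (trans eq (sym (f≗g y)))))
      , (λ y y∈D′ → let x , x∈D , eq = s y y∈D′ in x , x∈D , trans (sym (f≗g x)) eq)

    ∃∈-≡ : ∀ {S : Subset n} {x y : ∃ (_∈ S)} → proj₁ x ≡ proj₁ y → x ≡ y
    ∃∈-≡ {x = x , p} {y = .x , q} refl = cong (x ,_) ([]=-irrelevant p q)

    fromMap : ∀ {D D′} f → MatchingMap D D′ f → PerfectMatching D D′
    fromMap f (m , i , s) = mk⤖ {to = λ (x , x∈D) → f x , proj₁ (m x x∈D)}
        ( (λ {(x , x∈D)} {(y , y∈D)} eq → ∃∈-≡ (i x y x∈D y∈D (cong proj₁ eq)))
        , (λ (y , y∈D′) → let x , x∈D , eq = s y y∈D′ in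
             (x , x∈D) , λ where refl → ∃∈-≡ eq))
      , λ (x , x∈D) → proj₂ (m x x∈D)

    toMap : ∀ {D D′} → PerfectMatching D D′ → ∃ (MatchingMap D D′)
    toMap {D} {D′} (F , adj) = f
      , (λ x x∈D → subst (λ z → z ∈ D′ × Adj x z) (sym (f-to x x∈D))
           (proj₂ (to (x , x∈D)) , adj (x , x∈D)))
      , (λ x y x∈D y∈D eq → cong proj₁ (injective
           (∃∈-≡ (trans (sym (f-to x x∈D)) (trans eq (f-to y y∈D))))))
      , (λ y y∈D′ → let (x , x∈D) , eq = surjective (y , y∈D′) in
           x , x∈D , trans (f-to x x∈D) (cong proj₁ (eq refl)))
      where
      open Bijection F using (to; injective; surjective)
      f : Fin n → Fin n
      f x with x ∈? D
      ... | yes x∈D = proj₁ (to (x , x∈D))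
      ... | no  _   = x
      f-to : ∀ x (x∈D : x ∈ D) → f x ≡ proj₁ (to (x , x∈D))
      f-to x x∈D with x ∈? D
      ... | yes p   = cong (proj₁ ∘ to) (∃∈-≡ refl)
      ... | no  x∉D = ⊥-elim (x∉D x∈D)

  perfectMatching? : ∀ D D′ → Dec (PerfectMatching D D′)
  perfectMatching? D D′ = map′
    (λ (k , m) → fromMap (finToFun k) m)
    (λ p → let f , m = toMap p in
       funToFin f , MatchingMap-resp-≗ (sym ∘ finToFun-funToFin f) m)
    (any? λ k → matchingMap? D D′ (finToFun {n} {n} k))

  swapSet? : ∀ D → Dec (IsSwapSet D)
  swapSet? D = dominating? D ×-dec (anySubset? λ D′ →
    dominating? D′ ×-dec (¬? (nonempty? (D ∩ D′)) ×-dec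
      ((∣ D ∣ ℕ.≟ ∣ D′ ∣) ×-dec perfectMatching? D D′)))

  -- The default 0 is the size of the empty independent set, so it never overrides the maximum.
  α : ℕ
  α = Max.max 0 (map ∣_∣ (filter independent? (allSubsets n)))

  DDₘ : ℕ∞
  DDₘ = Min.min ⊤⁺ (map (λ D → [ ∣ D ∣ ]) (filter swapSet? (allSubsets n)))

  α-upper : ∀ S → IsIndependent S → ∣ S ∣ ≤ α
  α-upper S ind = All.lookup (Max.xs≤max 0 _)
    (∈-map⁺ ∣_∣ (∈-filter⁺ independent? (∈-allSubsets S) ind))

  α-attained : ∃[ S ] (IsIndependent S × ∣ S ∣ ≡ α)
  α-attained with Max.argmax-sel (λ x → x) 0 (map ∣_∣ (filter independent? (allSubsets n)))
  ... | inj₁ eq = ⊥ , (λ _ _ u∈⊥ → ⊥-elim (∉⊥ u∈⊥)) , trans (∣⊥∣≡0 n) (sym eq)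
  ... | inj₂ α∈ with ∈-map⁻ ∣_∣ α∈
  ...   | S , S∈ , eq = S , proj₂ (∈-filter⁻ independent? {xs = allSubsets n} S∈) , sym eq

  DDₘ-lower : ∀ D → IsSwapSet D → DDₘ ≤⁺ [ ∣ D ∣ ]
  DDₘ-lower D sw = All.lookup (Min.min≤xs ⊤⁺ _)
    (∈-map⁺ (λ D → [ ∣ D ∣ ]) (∈-filter⁺ swapSet? (∈-allSubsets D) sw))

  DDₘ-attained : ∀ {D} → IsSwapSet D → ∃[ D₀ ] (IsSwapSet D₀ × DDₘ ≡ [ ∣ D₀ ∣ ])
  DDₘ-attained {D} sw
    with Min.argmin-sel (λ x → x) ⊤⁺ (map (λ D → [ ∣ D ∣ ]) (filter swapSet? (allSubsets n)))
  ... | inj₁ eq = ⊥-elim (¬∞≤ (subst (_≤⁺ [ ∣ D ∣ ]) eq (DDₘ-lower D sw)))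
    where
    ¬∞≤ : ∀ {k} → ¬ (⊤⁺ ≤⁺ [ k ])
    ¬∞≤ ()
  ... | inj₂ d∈ with ∈-map⁻ (λ D → [ ∣ D ∣ ]) d∈
  ...   | D₀ , D₀∈ , eq = D₀ , proj₂ (∈-filter⁻ swapSet? {xs = allSubsets n} D₀∈) , eq

  DDₘ-∞ : ¬ ∃ IsSwapSet → DDₘ ≡ ⊤⁺
  DDₘ-∞ none
    with Min.argmin-sel (λ x → x) ⊤⁺ (map (λ D → [ ∣ D ∣ ]) (filter swapSet? (allSubsets n)))
  ... | inj₁ eq = eq
  ... | inj₂ d∈ with ∈-map⁻ (λ D → [ ∣ D ∣ ]) d∈
  ...   | D₀ , D₀∈ , _ =
    ⊥-elim (none (D₀ , proj₂ (∈-filter⁻ swapSet? {xs = allSubsets n} D₀∈)))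

{-# OPTIONS --safe #-}
-- Let I = {x₀, x₁, x₂} be a maximum independent set; it is dominating.  If some
-- independent triple J is disjoint from I, then Hall's condition between I and J holds,
-- since a violation would produce four independent vertices, and I is a swap set.
-- Otherwise, the given swap set excludes isolated vertices and pairs of leaves with a
-- common neighbour, and it is itself small when n ≤ 5; so Hall's theorem yields distinct
-- neighbours f₀, f₁, f₂ of x₀, x₁, x₂.  If they do not dominate some vertex u, choose xᵢ
-- adjacent to u and replace fᵢ by u.  The new triple contains the non-adjacent vertices
-- u and fⱼ, so a vertex w it does not dominate would give the independent triple
-- {u, fⱼ, w} disjoint from I.
module Submission where

open import Defs
open import Data.Empty using (⊥)
open import Data.Fin using (Fin; zero; suc; punchIn)
open import Data.Fin.Patterns using (0F; 1F; 2F)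
open import Data.Fin.Properties using (_≟_; any?; all?; ¬∀⟶∃¬; injective⇒≤; punchInᵢ≢i; punchIn-injective; suc-injective)
open import Data.Fin.Subset using (Subset; inside; outside; ⁅_⁆; _∪_; _∩_; ∣_∣; _∈_; _∉_; Empty) renaming (⊥ to ∅)
open import Data.Fin.Subset.Properties using (∉⊥; ∣⊥∣≡0; x∈⁅x⁆; x∈⁅y⁆⇒x≡y; x∈p∪q⁻; x∈p∪q⁺; x∈p∩q⁺; x∈p∩q⁻; x∉p⇒x∈∁p; ∪-identityˡ; ∣∁p∣≡n∸∣p∣; p⊆q⇒∣p∣≤∣q∣)
open import Data.Nat using (ℕ; zero; suc; s≤s; _≤_; _≤?_; _∸_)
open import Data.Nat.Properties using (1+n≰n; ≤-trans; ≤-reflexive; ∸-mono; ≰⇒>)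
open import Data.Product using (∃; ∃₂; ∃-syntax; _×_; _,_; proj₁; proj₂)
open import Data.Sum using (_⊎_; inj₁; inj₂)
open import Data.Vec using ([]; _∷_; here; there)
import Data.Vec.Functional as F
open import Data.Vec.Functional.Properties using (updateAt-updates; updateAt-minimal)
open import Data.Vec.Properties.WithK using ([]=-irrelevant)
open import Function using (_∘_; const; Injective)
open import Function.Bundles using (mk⤖; module Bijection)
open import Relation.Binary.Construct.Add.Supremum.NonStrict _≤_ using (≤⁺-trans) renaming ([_] to [_]≤)
open import Relation.Binary.PropositionalEquality using (_≡_; _≢_; refl; sym; trans; cong; subst)
open import Relation.Nullary using (¬_; yes; no; contradiction)
open import Relation.Nullary.Construct.Add.Supremum using ([_])
open import Relation.Nullary.Decidable using (_×-dec_; _⊎-dec_; ¬?; decidable-stable)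
open import Relation.Unary using (Pred; Decidable)
open import Level using (0ℓ)

private
  variable
    k m n : ℕ

Inj : (Fin k → Fin n) → Set
Inj = Injective _≡_ _≡_

∷-injective : ∀ {v} {x : Fin k → Fin n} → Inj x → (∀ i → x i ≢ v) → Inj (v F.∷ x)
∷-injective inj x≢v {zero}  {zero}  eq = refl
∷-injective inj x≢v {zero}  {suc j} eq = contradiction (sym eq) (x≢v j)
∷-injective inj x≢v {suc i} {zero}  eq = contradiction eq (x≢v i)
∷-injective inj x≢v {suc i} {suc j} eq = cong suc (inj eq)

surjective⇒≤ : (g : Fin k → Fin m) → (∀ v → ∃[ i ] g i ≡ v) → m ≤ k
surjective⇒≤ g sur = injective⇒≤ {f = proj₁ ∘ sur} λ {v} {w} eq →
  trans (sym (proj₂ (sur v))) (trans (cong g eq) (proj₂ (sur w)))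

-- Ranges of finite families as subsets

range : (Fin k → Fin n) → Subset n
range {zero}  x = ∅
range {suc k} x = ⁅ x zero ⁆ ∪ range (x ∘ suc)

∈-range⁺ : (x : Fin k → Fin n) → ∀ i → x i ∈ range x
∈-range⁺ x zero    = x∈p∪q⁺ (inj₁ (x∈⁅x⁆ (x zero)))
∈-range⁺ x (suc i) = x∈p∪q⁺ {p = ⁅ x zero ⁆} (inj₂ (∈-range⁺ (x ∘ suc) i))

∈-range⁻ : (x : Fin k → Fin n) → ∀ {v} → v ∈ range x → ∃[ i ] x i ≡ v
∈-range⁻ {zero}  x v∈ = contradiction v∈ ∉⊥
∈-range⁻ {suc k} x v∈ with x∈p∪q⁻ ⁅ x zero ⁆ _ v∈
... | inj₁ v∈⁅⁆ = zero , sym (x∈⁅y⁆⇒x≡y _ v∈⁅⁆)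
... | inj₂ v∈r  = let i , eq = ∈-range⁻ (x ∘ suc) v∈r in suc i , eq

∣⁅x⁆∪p∣≡1+∣p∣ : ∀ (x : Fin n) (p : Subset n) → x ∉ p → ∣ ⁅ x ⁆ ∪ p ∣ ≡ suc ∣ p ∣
∣⁅x⁆∪p∣≡1+∣p∣ zero    (inside  ∷ p) x∉p = contradiction here x∉p
∣⁅x⁆∪p∣≡1+∣p∣ zero    (outside ∷ p) x∉p = cong (suc ∘ ∣_∣) (∪-identityˡ p)
∣⁅x⁆∪p∣≡1+∣p∣ (suc x) (inside  ∷ p) x∉p = cong suc (∣⁅x⁆∪p∣≡1+∣p∣ x p (x∉p ∘ there))
∣⁅x⁆∪p∣≡1+∣p∣ (suc x) (outside ∷ p) x∉p = ∣⁅x⁆∪p∣≡1+∣p∣ x p (x∉p ∘ there)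

∣range∣ : (x : Fin k → Fin n) → Inj x → ∣ range x ∣ ≡ k
∣range∣ {zero}  {n} x inj = ∣⊥∣≡0 n
∣range∣ {suc k} x inj = trans
  (∣⁅x⁆∪p∣≡1+∣p∣ (x zero) _ λ x₀∈ → let i , eq = ∈-range⁻ (x ∘ suc) x₀∈ in
    contradiction (inj eq) λ ())
  (cong suc (∣range∣ (x ∘ suc) (suc-injective ∘ inj)))

enumerate : (p : Subset n) → ∃[ x ] (Inj {∣ p ∣} {n} x × ∀ i → x i ∈ p)
enumerate [] = (λ ()) , (λ { {()} }) , λ ()
enumerate (outside ∷ p) = let x , inj , x∈p = enumerate p in
  suc ∘ x , inj ∘ suc-injective , there ∘ x∈p
enumerate (inside ∷ p) = let x , inj , x∈p = enumerate p in
  zero F.∷ (suc ∘ x) , ∷-injective (inj ∘ suc-injective) (λ _ ()) ,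
  λ { zero → here ; (suc i) → there (x∈p i) }

-- Hall's theorem for three sets

-- `Sdr` abbreviates "system of distinct representatives".
Sdr₂ : (P Q : Pred (Fin m) 0ℓ) → Set
Sdr₂ P Q = ∃₂ λ u v → P u × Q v × u ≢ v

Sdr₃ : (P Q S : Pred (Fin m) 0ℓ) → Set
Sdr₃ P Q S = ∃₂ λ u v → ∃[ w ] (P u × Q v × S w × u ≢ v × u ≢ w × v ≢ w)

module _ {P Q : Pred (Fin m) 0ℓ} where

  -- A second element `v` of the union helps either way: in `Q` it is a partner for `u`; in `P` it
  -- leaves two candidates for `P`, one of which differs from `t`.
  hall₂ : ∃ P → ∃ Q → (∀ p → ∃[ v ] (v ≢ p × (P v ⊎ Q v))) → Sdr₂ P Q
  hall₂ (u , Pu) (t , Qt) two with two u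
  ... | v , v≢u , inj₂ Qv = u , v , Pu , Qv , v≢u ∘ sym
  ... | v , v≢u , inj₁ Pv with t ≟ u
  ...   | yes refl = v , t , Pv , Qt , v≢u
  ...   | no  t≢u  = u , t , Pu , Qt , t≢u ∘ sym

  module _ {S : Pred (Fin m) 0ℓ} where

    swapSdr₃ : Sdr₃ Q P S → Sdr₃ P Q S
    swapSdr₃ (u , v , w , Qu , Pv , Sw , u≢v , u≢w , v≢w) =
      v , u , w , Pv , Qu , Sw , u≢v ∘ sym , v≢w , u≢w

    -- The spare `w` lets `P` give up `u`. If `t` collides with `u`, then `P` moves to `w`. If `t`
    -- collides with `v`, then `Q` or `S` takes a new element `s` instead of `v`, and `P` moves to
    -- `w` in case `s` is `u`.
    extend : ((u , v , _) : Sdr₂ P Q) → ∃[ w ] (P w × w ≢ u × w ≢ v) → ∃ S →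
             (∀ p → ∃[ s ] (s ≢ p × (Q s ⊎ S s))) → Sdr₃ P Q S
    extend (u , v , Pu , Qv , u≢v) (w , Pw , w≢u , w≢v) (t , St) two
      with t ≟ u | t ≟ v
    ... | yes refl | _      = w , v , t , Pw , Qv , St , w≢v , w≢u , u≢v ∘ sym
    ... | no t≢u   | no t≢v = u , v , t , Pu , Qv , St , u≢v , t≢u ∘ sym , t≢v ∘ sym
    ... | no _     | yes refl with two v
    ...   | s , s≢v , r with s ≟ u | r
    ...     | yes refl | inj₁ Qs = w , s , v , Pw , Qs , St , w≢u , w≢v , s≢v
    ...     | no s≢u   | inj₁ Qs = u , s , v , Pu , Qs , St , s≢u ∘ sym , u≢v , s≢v
    ...     | yes refl | inj₂ Ss = w , v , s , Pw , Qv , Ss , w≢v , w≢u , s≢v ∘ sym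
    ...     | no s≢u   | inj₂ Ss = u , v , s , Pu , Qv , Ss , u≢v , s≢u ∘ sym , s≢v ∘ sym

-- The last two Hall conditions are negative because the graph arguments refute inclusions in one or
-- two elements; decidability turns them back into witnesses.
module _ (R : Fin 3 → Pred (Fin m) 0ℓ) (R? : ∀ i → Decidable (R i))
         (hall-1 : ∀ i → ∃ (R i))
         (hall-2 : ∀ {i j} → i ≢ j → ∀ p → ¬ (∀ v → R i v ⊎ R j v → v ≡ p))
         (hall-3 : ∀ p q → ¬ (∀ i v → R i v → v ≡ p ⊎ v ≡ q))
  where

  private
    two : ∀ {i j} → i ≢ j → ∀ p → ∃[ v ] (v ≢ p × (R i v ⊎ R j v))
    two {i} {j} i≢j p with any? (λ v → ¬? (v ≟ p) ×-dec (R? i v ⊎-dec R? j v))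
    ... | yes found = found
    ... | no  none  = contradiction
      (λ v r → decidable-stable (v ≟ p) λ v≢p → none (v , v≢p , r)) (hall-2 i≢j p)

    three : ∀ p q → ∃₂ λ i v → R i v × v ≢ p × v ≢ q
    three p q with any? (λ i → any? λ v → R? i v ×-dec (¬? (v ≟ p) ×-dec ¬? (v ≟ q)))
    ... | yes found = found
    ... | no  none  = contradiction
      (λ i v r → decidable-stable ((v ≟ p) ⊎-dec (v ≟ q)) λ v≢pq →
        none (i , v , r , v≢pq ∘ inj₁ , v≢pq ∘ inj₂)) (hall-3 p q)

    sdr : Sdr₃ (R 0F) (R 1F) (R 2F)
    sdr with hall₂ (hall-1 0F) (hall-1 1F) (two λ ())
    -- The new element represents `R 2F` if it lies there; otherwise it is the spare that `extend`
    -- needs.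
    ... | s@(u , v , Ru , Rv , u≢v) with three u v
    ...   | 0F , w , Rw , w≢u , w≢v = extend s (w , Rw , w≢u , w≢v) (hall-1 2F) (two λ ())
    ...   | 1F , w , Rw , w≢u , w≢v = swapSdr₃
      (extend (v , u , Rv , Ru , u≢v ∘ sym) (w , Rw , w≢v , w≢u) (hall-1 2F) (two λ ()))
    ...   | 2F , w , Rw , w≢u , w≢v =
      u , v , w , Ru , Rv , Rw , u≢v , w≢u ∘ sym , w≢v ∘ sym

  hall₃ : ∃[ f ] (Inj {3} f × ∀ i → R i (f i))
  hall₃ = let u , v , w , Ru , Rv , Rw , u≢v , u≢w , v≢w = sdr in
    u F.∷ v F.∷ w F.∷ F.[] ,
    ∷-injective {k = 2} (∷-injective {k = 1} (∷-injective (λ { {()} }) λ ()) λ { 0F → v≢w ∘ sym })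
      (λ { 0F → u≢v ∘ sym ; 1F → u≢w ∘ sym }) ,
    λ { 0F → Ru ; 1F → Rv ; 2F → Rw }

-- Independent, dominating and matched families of vertices

∃∈-≡ : ∀ {p : Subset n} {x y : ∃ (_∈ p)} → proj₁ x ≡ proj₁ y → x ≡ y
∃∈-≡ {x = x , p} {y = .x , q} refl = cong (x ,_) ([]=-irrelevant p q)

module _ (G : Graph n) where
  open Graph G

  Small : ℕ → Set
  Small k = ∃[ D ] (IsSwapSet G D × ∣ D ∣ ≤ k)

  -- Families rather than subsets, so that vertices can be prepended, dropped or permuted by
  -- reindexing.
  IndependentFamily : (Fin k → Fin n) → Set
  IndependentFamily x = Inj x × ∀ i j → ¬ Adj (x i) (x j)

  Dominated : (Fin k → Fin n) → Fin n → Set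
  Dominated x v = ∃[ i ] (x i ≡ v ⊎ Adj (x i) v)

  dominated? : (x : Fin k → Fin n) → Decidable (Dominated x)
  dominated? x v = any? λ i → (x i ≟ v) ⊎-dec adj? (x i) v

  dominatesOrMisses : (x : Fin k → Fin n) → (∀ v → Dominated x v) ⊎ ∃[ v ] ¬ Dominated x v
  dominatesOrMisses x with all? (dominated? x)
  ... | yes dom = inj₁ dom
  ... | no ¬dom = inj₂ (¬∀⟶∃¬ n _ (dominated? x) ¬dom)

  independent-∷ : ∀ {v} {x : Fin k → Fin n} → IndependentFamily x → ¬ Dominated x v →
                  IndependentFamily (v F.∷ x)
  independent-∷ {v = v} {x} (inj , ind) ¬dom =
    ∷-injective inj (λ i eq → ¬dom (i , inj₁ eq)) , λ where
      zero    zero    → adj-irrefl refl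
      zero    (suc j) → λ a → ¬dom (j , inj₂ (adj-sym a))
      (suc i) zero    → λ a → ¬dom (i , inj₂ a)
      (suc i) (suc j) → ind i j

  independent-∘ : ∀ {x : Fin m → Fin n} {g : Fin k → Fin m} → Inj g →
                  IndependentFamily x → IndependentFamily (x ∘ g)
  independent-∘ {g = g} g-inj (inj , ind) = g-inj ∘ inj , λ i j → ind (g i) (g j)

  independent-≤α : (x : Fin k → Fin n) → IndependentFamily x → k ≤ α G
  independent-≤α x (inj , ind) = subst (_≤ α G) (∣range∣ x inj) (α-upper G (range x)
    λ u v u∈ v∈ → ind′ (∈-range⁻ x u∈) (∈-range⁻ x v∈))
    where
    ind′ : ∀ {u v} → ∃[ i ] x i ≡ u → ∃[ j ] x j ≡ v → ¬ Adj u v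
    ind′ (i , refl) (j , refl) = ind i j

  matched⇒swapSet : (x y : Fin k → Fin n) → Inj x → Inj y → (∀ i j → x i ≢ y j) →
                    (∀ i → Adj (x i) (y i)) →
                    (∀ v → Dominated x v) → (∀ v → Dominated y v) → Small k
  matched⇒swapSet {k} x y x-inj y-inj x≢y adj x-dom y-dom =
    range x ,
    (dominating x x-dom , range y , dominating y y-dom , disjoint ,
      trans (∣range∣ x x-inj) (sym (∣range∣ y y-inj)) ,
      mk⤖ {to = to} ((λ {u} {v} → to-injective {u} {v}) , to-surjective) , adj-to) ,
    ≤-reflexive (∣range∣ x x-inj)
    where
    dominating : (z : Fin k → Fin n) → (∀ v → Dominated z v) → IsDominating G (range z)
    dominating z dom v with dom v
    ... | i , inj₁ refl = inj₁ (∈-range⁺ z i)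
    ... | i , inj₂ a    = inj₂ (z i , ∈-range⁺ z i , a)

    disjoint : Empty (range x ∩ range y)
    disjoint (v , v∈) with x∈p∩q⁻ (range x) (range y) v∈
    ... | v∈x , v∈y with ∈-range⁻ x v∈x | ∈-range⁻ y v∈y
    ...   | i , refl | j , eq = x≢y i j (sym eq)

    index : ∃ (_∈ range x) → Fin k
    index (v , v∈) = proj₁ (∈-range⁻ x v∈)

    x-index : ∀ u → x (index u) ≡ proj₁ u
    x-index (v , v∈) = proj₂ (∈-range⁻ x v∈)

    to : ∃ (_∈ range x) → ∃ (_∈ range y)
    to u = y (index u) , ∈-range⁺ y (index u)

    to-injective : ∀ {u v} → to u ≡ to v → u ≡ v
    to-injective {u} {v} eq = ∃∈-≡ (trans (sym (x-index u))
      (trans (cong x (y-inj (cong proj₁ eq))) (x-index v)))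

    to-surjective : ∀ w → ∃[ u ] (∀ {z} → z ≡ u → to z ≡ w)
    to-surjective (w , w∈) = let i , eq = ∈-range⁻ y w∈ in
      (x i , ∈-range⁺ x i) ,
      -- The index that `∈-range⁻` finds for `x i` equals `i` only by injectivity of `x`.
      λ { refl → ∃∈-≡ (trans (cong y (x-inj (x-index (x i , ∈-range⁺ x i)))) eq) }

    adj-to : ∀ u → Adj (proj₁ u) (proj₁ (to u))
    adj-to u = subst (λ v → Adj v (y (index u))) (x-index u) (adj (index u))

  -- Consequences of the existence of a swap set

  module _ {D} (swap : IsSwapSet G D) where
    private
      D-dom    = proj₁ swap
      D′       = proj₁ (proj₂ swap)
      D′-dom   = proj₁ (proj₂ (proj₂ swap))
      disjoint = proj₁ (proj₂ (proj₂ (proj₂ swap)))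
      ∣D∣≡∣D′∣   = proj₁ (proj₂ (proj₂ (proj₂ (proj₂ swap))))
      matching = proj₂ (proj₂ (proj₂ (proj₂ (proj₂ swap))))
      adj      = proj₂ matching
      open Bijection (proj₁ matching) using (to; injective; surjective)

      ¬both : ∀ {v} → v ∈ D → v ∈ D′ → ⊥
      ¬both v∈D v∈D′ = disjoint (_ , x∈p∩q⁺ (v∈D , v∈D′))

    noIsolated : ∀ v → ∃[ w ] Adj v w
    noIsolated v with D-dom v
    ... | inj₁ v∈D         = _ , adj (v , v∈D)
    ... | inj₂ (w , _ , a) = w , adj-sym a

    -- Only `a` and `p` can dominate `a`, and `p` cannot lie in both disjoint sets. So `a` lies in
    -- `D` or `D′`, and its partner, being a neighbour, is `p`.
    leafEdgeMatched : ∀ {a p} → (∀ v → Adj a v → v ≡ p) →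
                      (∃[ a∈D ] proj₁ (to (a , a∈D)) ≡ p) ⊎ (∃[ p∈D ] proj₁ (to (p , p∈D)) ≡ a)
    leafEdgeMatched {a} leaf with D-dom a
    ... | inj₁ a∈D = inj₁ (a∈D , leaf _ (adj (a , a∈D)))
    ... | inj₂ (d , d∈D , d~a) with leaf d (adj-sym d~a) | D′-dom a
    ...   | refl | inj₂ (d′ , d′∈D′ , d′~a) with leaf d′ (adj-sym d′~a)
    ...     | refl = contradiction d′∈D′ (¬both d∈D)
    leafEdgeMatched {a} leaf | inj₂ (d , d∈D , d~a) | refl | inj₁ a∈D′
      with surjective (a , a∈D′)
    ...   | (z , z∈D) , to≡ with cong proj₁ (to≡ refl)
    ...     | refl with leaf z (adj-sym (adj (z , z∈D)))
    ...       | refl = inj₂ (z∈D , refl)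

    -- Both `a` and `b` would be matched with `p`. On the same side this contradicts bijectivity; on
    -- opposite sides it puts `p` into both `D` and `D′`.
    noTwinLeaves : ∀ {a b} → a ≢ b → ∀ p → ¬ (∀ v → Adj a v ⊎ Adj b v → v ≡ p)
    noTwinLeaves a≢b p leaves
      with leafEdgeMatched (λ v → leaves v ∘ inj₁) | leafEdgeMatched (λ v → leaves v ∘ inj₂)
    ... | inj₁ (a∈D , eq)  | inj₁ (b∈D , eq′) =
      a≢b (cong proj₁ (injective (∃∈-≡ (trans eq (sym eq′)))))
    ... | inj₂ (p∈D , eq)  | inj₂ (p∈D′ , eq′) =
      a≢b (trans (sym eq) (trans (cong (proj₁ ∘ to) (∃∈-≡ refl)) eq′))
    ... | inj₁ (a∈D , refl) | inj₂ (p∈D , _) = ¬both p∈D (proj₂ (to (_ , a∈D)))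
    ... | inj₂ (p∈D , _) | inj₁ (b∈D , refl) = ¬both p∈D (proj₂ (to (_ , b∈D)))

    n≤5⇒small : n ≤ 5 → Small 3
    n≤5⇒small n≤5 with ∣ D ∣ ≤? 3
    ... | yes ∣D∣≤3 = D , swap , ∣D∣≤3
    ... | no  ∣D∣≰3 = contradiction
      -- Since `D′` fits into the complement of `D`, a size of at least 4 would give 4 ≤ `n ∸ ∣ D ∣`
      -- ≤ 5 ∸ 4.
      (≤-trans (≰⇒> ∣D∣≰3) (≤-trans ∣D∣≤n∸∣D∣ (∸-mono n≤5 (≰⇒> ∣D∣≰3)))) λ { (s≤s ()) }
      where
      ∣D∣≤n∸∣D∣ : ∣ D ∣ ≤ n ∸ ∣ D ∣
      ∣D∣≤n∸∣D∣ = ≤-trans (≤-reflexive ∣D∣≡∣D′∣) (≤-trans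
        (p⊆q⇒∣p∣≤∣q∣ λ v∈D′ → x∉p⇒x∈∁p λ v∈D → ¬both v∈D v∈D′) (≤-reflexive (∣∁p∣≡n∸∣p∣ D)))

  -- Graphs with independence number at most three

  module _ (α≤3 : α G ≤ 3) where

    no-4-independent : (x : Fin 4 → Fin n) → ¬ IndependentFamily x
    no-4-independent x ind = contradiction (≤-trans (independent-≤α x ind) α≤3) 1+n≰n

    independent⇒dominating : (x : Fin 3 → Fin n) → IndependentFamily x → ∀ v → Dominated x v
    independent⇒dominating x ind v = decidable-stable (dominated? x v) λ ¬dom →
      no-4-independent (v F.∷ x) (independent-∷ ind ¬dom)

    module _ {x : Fin 3 → Fin n} (x-ind : IndependentFamily x) where

      private
        x-dom = independent⇒dominating x x-ind

      -- Hall's theorem is applied to indices of `y`, so the matched triple is a reindexing of `y`: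
      -- it stays independent and hence dominating.
      disjointTriples⇒small : (y : Fin 3 → Fin n) → IndependentFamily y →
                              (∀ i j → x i ≢ y j) → Small 3
      disjointTriples⇒small y y-ind x≢y = fromMatching
        (hall₃ (λ i j → Adj (x i) (y j)) (λ i j → adj? (x i) (y j)) hall-1 hall-2 hall-3)
        where
        fromMatching : ∃[ f ] (Inj {3} f × ∀ i → Adj (x i) (y (f i))) → Small 3
        fromMatching (f , f-inj , x~yf) =
          matched⇒swapSet x (y ∘ f) (proj₁ x-ind) (f-inj ∘ proj₁ y-ind) (λ i j → x≢y i (f j))
            x~yf x-dom (independent⇒dominating (y ∘ f) (independent-∘ f-inj y-ind))

        hall-1 : ∀ i → ∃[ j ] Adj (x i) (y j)
        hall-1 i with independent⇒dominating y y-ind (x i)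
        ... | j , inj₁ eq = contradiction (sym eq) (x≢y i j)
        ... | j , inj₂ a  = j , adj-sym a

        hall-2 : ∀ {i j} → i ≢ j → ∀ p →
                 ¬ (∀ v → Adj (x i) (y v) ⊎ Adj (x j) (y v) → v ≡ p)
        -- `punchIn p` lists the two vertices of `y` other than `y p`; neither is adjacent to `x i`
        -- or `x j`, so the four are independent.
        hall-2 {i} {j} i≢j p only = no-4-independent (x i F.∷ x j F.∷ y ∘ punchIn p)
          (independent-∷ (independent-∷ (independent-∘ (punchIn-injective p _ _) y-ind)
            (missed j inj₂)) λ where
              (zero  , inj₁ eq) → i≢j (proj₁ x-ind (sym eq))
              (zero  , inj₂ a)  → proj₂ x-ind j i a
              (suc l , d)       → missed i inj₁ (l , d))
          where
          missed : ∀ h → (∀ {v} → Adj (x h) (y v) → Adj (x i) (y v) ⊎ Adj (x j) (y v)) →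
                   ¬ Dominated (y ∘ punchIn p) (x h)
          missed h inj (l , inj₁ eq) = x≢y h (punchIn p l) (sym eq)
          missed h inj (l , inj₂ a)  = punchInᵢ≢i p l (only _ (inj (adj-sym a)))

        hall-3 : ∀ p q → ¬ (∀ i v → Adj (x i) (y v) → v ≡ p ⊎ v ≡ q)
        -- Every `y v` has a neighbour in `x`, so all three indices would lie among `p` and `q`.
        hall-3 p q only = contradiction (surjective⇒≤ (p F.∷ q F.∷ F.[]) covered) 1+n≰n
          where
          covered : ∀ v → ∃[ i ] (p F.∷ q F.∷ F.[]) i ≡ v
          covered v with x-dom (y v)
          ... | i , inj₁ eq = contradiction eq (x≢y i v)
          ... | i , inj₂ a with only i v a
          ...   | inj₁ refl = 0F , refl
          ...   | inj₂ refl = 1F , refl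

      module _ {f : Fin 3 → Fin n} (f-inj : Inj f) (x~f : ∀ i → Adj (x i) (f i)) where

        private
          x≢f : ∀ i j → x i ≢ f j
          x≢f i j eq = proj₂ x-ind j i (subst (Adj (x j)) (sym eq) (x~f j))

          missed⇒≢x : ∀ {v} → ¬ Dominated f v → ∀ i → x i ≢ v
          missed⇒≢x ¬dom i refl = ¬dom (i , inj₂ (adj-sym (x~f i)))

        dominating⇒small : (∀ v → Dominated f v) → Small 3
        dominating⇒small = matched⇒swapSet x f (proj₁ x-ind) f-inj x≢f x~f x-dom

        -- A vertex missed by `f` forms an independent triple with `f i` and `f j`. It is disjoint
        -- from `x`, because `f` dominates every `x l` and no neighbour of some `x l` lies in `x`.
        nonClique⇒small : ∀ {i j} → i ≢ j → ¬ Adj (f i) (f j) → Small 3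
        nonClique⇒small {i} {j} i≢j fi≁fj with dominatesOrMisses f
        ... | inj₁ dom        = dominating⇒small dom
        ... | inj₂ (w , ¬dom) = disjointTriples⇒small (w F.∷ f i F.∷ f j F.∷ F.[])
          (independent-∷ {k = 2} (independent-∷ {k = 1} (independent-∷ ((λ { {()} }) , λ ()) λ ())
            λ { (0F , inj₁ eq) → i≢j (f-inj (sym eq)) ; (0F , inj₂ a) → fi≁fj (adj-sym a) })
            λ { (0F , d) → ¬dom (i , d) ; (1F , d) → ¬dom (j , d) })
          λ { l 0F → missed⇒≢x ¬dom l ; l 1F → x≢f l i ; l 2F → x≢f l j }

      representatives⇒small : ∃[ f ] (Inj {3} f × ∀ i → Adj (x i) (f i)) → Small 3
      representatives⇒small (f , f-inj , x~f) with dominatesOrMisses f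
      ... | inj₁ dom        = dominating⇒small f-inj x~f dom
      ... | inj₂ (u , ¬dom) with x-dom u
      ...   | i , inj₁ refl = contradiction (i , inj₂ (adj-sym (x~f i))) ¬dom
      -- `punchIn i 0F` is just some index other than `i`; the missed vertex `u` is non-adjacent to
      -- every `f l`, so any would do.
      ...   | i , inj₂ xi~u = nonClique⇒small f′-inj x~f′ (punchInᵢ≢i i 0F ∘ sym) f′i≁f′j
        where
        f′ = F.updateAt f i (const u)

        f′≡u : f′ i ≡ u
        f′≡u = updateAt-updates i f

        f′≡f : ∀ {l} → l ≢ i → f′ l ≡ f l
        f′≡f {l} l≢i = updateAt-minimal l i f l≢i

        f≢u : ∀ l → f l ≢ u
        f≢u l eq = ¬dom (l , inj₁ eq)

        f′-inj : Inj f′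
        f′-inj {l} {h} eq with l ≟ i | h ≟ i
        ... | yes refl | yes refl = refl
        ... | yes refl | no  h≢i  =
          contradiction (trans (sym (f′≡f h≢i)) (trans (sym eq) f′≡u)) (f≢u h)
        ... | no  l≢i  | yes refl =
          contradiction (trans (sym (f′≡f l≢i)) (trans eq f′≡u)) (f≢u l)
        ... | no  l≢i  | no  h≢i  = f-inj (trans (sym (f′≡f l≢i)) (trans eq (f′≡f h≢i)))

        x~f′ : ∀ l → Adj (x l) (f′ l)
        x~f′ l with l ≟ i
        ... | yes refl = subst (Adj (x i)) (sym f′≡u) xi~u
        ... | no  l≢i  = subst (Adj (x l)) (sym (f′≡f l≢i)) (x~f l)

        f′i≁f′j : ¬ Adj (f′ i) (f′ (punchIn i 0F))
        f′i≁f′j a rewrite f′≡u | f′≡f (punchInᵢ≢i i 0F) = ¬dom (punchIn i 0F , inj₂ (adj-sym a))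

      swapSet⇒small : ∃ (IsSwapSet G) → Small 3
      -- The threshold is 2 + 3: if `p` and `q` were the only neighbours of the dominating triple
      -- `x`, these five entries would cover all vertices.
      swapSet⇒small (D , swap) with n ≤? 5
      ... | yes n≤5 = n≤5⇒small swap n≤5
      ... | no  n≰5 = representatives⇒small (hall₃ (Adj ∘ x) (adj? ∘ x) (noIsolated swap ∘ x)
          (λ i≢j → noTwinLeaves swap (i≢j ∘ proj₁ x-ind))
          (λ p q only → n≰5 (surjective⇒≤ (p F.∷ q F.∷ x) (covered only))))
        where
        covered : ∀ {p q} → (∀ i v → Adj (x i) v → v ≡ p ⊎ v ≡ q) →
                  ∀ v → ∃[ i ] (p F.∷ q F.∷ x) i ≡ v
        covered only v with x-dom v
        ... | i , inj₁ eq = suc (suc i) , eq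
        ... | i , inj₂ a with only i v a
        ...   | inj₁ refl = 0F , refl
        ...   | inj₂ refl = 1F , refl

  independentTriple : α G ≡ 3 → ∃[ x ] IndependentFamily {3} x
  independentTriple α≡3 with α-attained G
  ... | S , ind , ∣S∣≡α with enumerate S
  -- Naming `enum` first lets the rewrite change its index type from `Fin ∣ S ∣` to `Fin 3`.
  ...   | enum rewrite trans ∣S∣≡α α≡3 = let x , inj , x∈S = enum in
    x , inj , λ i j → ind (x i) (x j) (x∈S i) (x∈S j)

theorem33 : ∀ {n : ℕ} (G : Graph n) → Connected G → ∃ (IsSwapSet G) → α G ≡ 3 → DDₘ G ≤⁺ [ α G ]
theorem33 G _ swap α≡3 =
  let x , x-ind     = independentTriple G α≡3
      D , sw , ∣D∣≤3 = swapSet⇒small G (≤-reflexive α≡3) x-ind swap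
  in ≤⁺-trans ≤-trans (DDₘ-lower G D sw) [ ≤-trans ∣D∣≤3 (≤-reflexive (sym α≡3)) ]≤
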